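{- Suppose $(a_1,a_2,a_3)\in\mathbb Z^3$ is one of the twelve triples $$(0,-2,1),\ (1,0,0),\ (-2,0,0),\ (0,1,-2),\ (1,-4,0),\ (0,2,1),\ (-4,1,2),\ (2,0,-4),\ (0,-5,1),\ (1,3,0),\ (-5,0,3),\ (3,1,-5),$$ or belongs to one of the four infinite families $(0,-2m-2,2m+1)$, $(2m+1,0,0)$, $(-2m-2,0,0)$, $(0,2m+1,-2m-2)$ with $m$ a nonnegative integer. Then the indefinite integral $$\int \frac{(1-k^2)^{a_1}(1+k-k^2)^{a_2}(1-4k-k^2)^{a_3}}{k^{a_1+a_2+a_3+1}}\,dk$$ is a rational function of $k$; that is, there is a rational function $g(k)$ whose derivative equals the integrand. -}

module Defs where

open import Agda.Builtin.FromNat using (Number; fromNat)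
open import Agda.Builtin.FromNeg using (Negative; fromNeg)
open import Data.Integer.Base as ℤ using (ℤ; +_; -[1+_])
import Data.Integer.Literals as ℤ-Literals
open import Data.List.Base using (List; []; _∷_; map)
open import Data.Nat.Base as ℕ using (ℕ; zero; suc)
import Data.Nat.Literals as ℕ-Literals
open import Data.Product.Base using (_×_; _,_)
open import Data.Rational.Base as ℚ using (ℚ; 0ℚ; 1ℚ)
import Data.Rational.Literals as ℚ-Literals
open import Data.Rational.Properties as ℚₚ using (_≟_)
open import Data.Sum.Base using (_⊎_; inj₁; inj₂; [_,_]′)
open import Data.Unit.Base using (⊤; tt)
open import Relation.Binary.PropositionalEquality
open import Relation.Nullary.Decidable.Core using (yes; no)
open import Relation.Nullary.Negation.Core using (¬_; contradiction)

instance
  ℕ-number : Number ℕ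
  ℕ-number = ℕ-Literals.number

  ℤ-number : Number ℤ
  ℤ-number = ℤ-Literals.number

  ℤ-negative : Negative ℤ
  ℤ-negative = ℤ-Literals.negative

  ℚ-number : Number ℚ
  ℚ-number = ℚ-Literals.number

  ℚ-negative : Negative ℚ
  ℚ-negative = ℚ-Literals.negative

infix  4 _≈ₚ_ _≃_
infixl 6 _+ₚ_ _-ₚ_
infixl 7 _*ₚ_ _*_
infixr 8 _^ⁿ_ _^⟨_⟩_
infix  9 _′

-- The polynomial c₀ + c₁k + c₂k² + ⋯ is the list c₀ ∷ c₁ ∷ c₂ ∷ ⋯.  Trailing
-- zeros are allowed, so polynomials are compared with _≈ₚ_, not with _≡_.
Poly : Set
Poly = List ℚ

coeff : Poly → ℕ → ℚ
coeff []      _       = 0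
coeff (c ∷ p) zero    = c
coeff (c ∷ p) (suc n) = coeff p n

_≈ₚ_ : Poly → Poly → Set
p ≈ₚ q = ∀ n → coeff p n ≡ coeff q n

_+ₚ_ : Poly → Poly → Poly
[]      +ₚ q       = q
p       +ₚ []      = p
(c ∷ p) +ₚ (d ∷ q) = (c ℚ.+ d) ∷ (p +ₚ q)

scale : ℚ → Poly → Poly
scale c = map (c ℚ.*_)

_-ₚ_ : Poly → Poly → Poly
p -ₚ q = p +ₚ scale -1 q

_*ₚ_ : Poly → Poly → Poly
[]      *ₚ q = []
(c ∷ p) *ₚ q = scale c q +ₚ (0 ∷ (p *ₚ q))

-- scaleFrom n (c₀ ∷ c₁ ∷ ⋯) is n·c₀ ∷ (n+1)·c₁ ∷ ⋯.
scaleFrom : ℕ → Poly → Poly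
scaleFrom n []      = []
scaleFrom n (c ∷ p) = (fromNat n ℚ.* c) ∷ scaleFrom (suc n) p

derivₚ : Poly → Poly
derivₚ []      = []
derivₚ (c ∷ p) = scaleFrom 1 p

NonZeroₚ : Poly → Set
NonZeroₚ p = ¬ (p ≈ₚ [])

coeff-+ : ∀ p q n → coeff (p +ₚ q) n ≡ coeff p n ℚ.+ coeff q n
coeff-+ []      q       n       = sym (ℚₚ.+-identityˡ _)
coeff-+ (c ∷ p) []      n       = sym (ℚₚ.+-identityʳ _)
coeff-+ (c ∷ p) (d ∷ q) zero    = refl
coeff-+ (c ∷ p) (d ∷ q) (suc n) = coeff-+ p q n

coeff-scale : ∀ c p n → coeff (scale c p) n ≡ c ℚ.* coeff p n
coeff-scale c []      n       = sym (ℚₚ.*-zeroʳ c)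
coeff-scale c (d ∷ p) zero    = refl
coeff-scale c (d ∷ p) (suc n) = coeff-scale c p n

coeff-*-zero : ∀ c p q → coeff ((c ∷ p) *ₚ q) 0 ≡ c ℚ.* coeff q 0
coeff-*-zero c p q = begin
  coeff (scale c q +ₚ (0 ∷ (p *ₚ q))) 0  ≡⟨ coeff-+ (scale c q) _ 0 ⟩
  coeff (scale c q) 0 ℚ.+ 0ℚ             ≡⟨ ℚₚ.+-identityʳ _ ⟩
  coeff (scale c q) 0                    ≡⟨ coeff-scale c q 0 ⟩
  c ℚ.* coeff q 0                        ∎
  where open ≡-Reasoning

coeff-*-suc : ∀ c p q n →
  coeff ((c ∷ p) *ₚ q) (suc n) ≡ c ℚ.* coeff q (suc n) ℚ.+ coeff (p *ₚ q) n
coeff-*-suc c p q n = begin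
  coeff (scale c q +ₚ (0 ∷ (p *ₚ q))) (suc n)      ≡⟨ coeff-+ (scale c q) _ (suc n) ⟩
  coeff (scale c q) (suc n) ℚ.+ coeff (p *ₚ q) n   ≡⟨ cong (ℚ._+ _) (coeff-scale c q (suc n)) ⟩
  c ℚ.* coeff q (suc n) ℚ.+ coeff (p *ₚ q) n       ∎
  where open ≡-Reasoning

*-shift-zero : ∀ p q → coeff (p *ₚ (0ℚ ∷ q)) 0 ≡ 0ℚ
*-shift-zero []      q = refl
*-shift-zero (c ∷ p) q = trans (coeff-*-zero c p (0ℚ ∷ q)) (ℚₚ.*-zeroʳ c)

*-shift-suc : ∀ p q n → coeff (p *ₚ (0ℚ ∷ q)) (suc n) ≡ coeff (p *ₚ q) n
*-shift-suc []      q n       = refl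
*-shift-suc (c ∷ p) q zero    = begin
  coeff ((c ∷ p) *ₚ (0ℚ ∷ q)) 1                      ≡⟨ coeff-*-suc c p (0ℚ ∷ q) 0 ⟩
  c ℚ.* coeff q 0 ℚ.+ coeff (p *ₚ (0ℚ ∷ q)) 0        ≡⟨ cong (c ℚ.* coeff q 0 ℚ.+_) (*-shift-zero p q) ⟩
  c ℚ.* coeff q 0 ℚ.+ 0ℚ                             ≡⟨ ℚₚ.+-identityʳ _ ⟩
  c ℚ.* coeff q 0                                    ≡⟨ coeff-*-zero c p q ⟨
  coeff ((c ∷ p) *ₚ q) 0                             ∎
  where open ≡-Reasoning
*-shift-suc (c ∷ p) q (suc n) = begin
  coeff ((c ∷ p) *ₚ (0ℚ ∷ q)) (suc (suc n))                ≡⟨ coeff-*-suc c p (0ℚ ∷ q) (suc n) ⟩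
  c ℚ.* coeff q (suc n) ℚ.+ coeff (p *ₚ (0ℚ ∷ q)) (suc n)  ≡⟨ cong (c ℚ.* coeff q (suc n) ℚ.+_) (*-shift-suc p q n) ⟩
  c ℚ.* coeff q (suc n) ℚ.+ coeff (p *ₚ q) n               ≡⟨ coeff-*-suc c p q n ⟨
  coeff ((c ∷ p) *ₚ q) (suc n)                             ∎
  where open ≡-Reasoning

ℚ-cancel : ∀ {c d} → ¬ (c ≡ 0ℚ) → c ℚ.* d ≡ 0ℚ → d ≡ 0ℚ
ℚ-cancel {c} {d} c≢0 cd≡0 = begin
  d                          ≡⟨ ℚₚ.*-identityˡ d ⟨
  1ℚ ℚ.* d                   ≡⟨ cong (ℚ._* d) (ℚₚ.*-inverseˡ c) ⟨
  (ℚ.1/ c) ℚ.* c ℚ.* d       ≡⟨ ℚₚ.*-assoc (ℚ.1/ c) c d ⟩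
  (ℚ.1/ c) ℚ.* (c ℚ.* d)     ≡⟨ cong ((ℚ.1/ c) ℚ.*_) cd≡0 ⟩
  (ℚ.1/ c) ℚ.* 0ℚ            ≡⟨ ℚₚ.*-zeroʳ (ℚ.1/ c) ⟩
  0ℚ                         ∎
  where
  open ≡-Reasoning
  instance _ = ℚ.≢-nonZero c≢0

*-cancel-unit : ∀ c p q → ¬ (c ≡ 0ℚ) → (c ∷ p) *ₚ q ≈ₚ [] → q ≈ₚ []
*-cancel-unit c p []      c≢0 pq≈0 n       = refl
*-cancel-unit c p (d ∷ q) c≢0 pq≈0 zero    =
  ℚ-cancel c≢0 (trans (sym (coeff-*-zero c p (d ∷ q))) (pq≈0 0))
*-cancel-unit c p (d ∷ q) c≢0 pq≈0 (suc n)
  with refl ← ℚ-cancel c≢0 (trans (sym (coeff-*-zero c p (d ∷ q))) (pq≈0 0))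
  = *-cancel-unit c p q c≢0
      (λ m → trans (sym (*-shift-suc (c ∷ p) q m)) (pq≈0 (suc m))) n

*-zero-head : ∀ p q → (0ℚ ∷ p) *ₚ q ≈ₚ [] → p *ₚ q ≈ₚ []
*-zero-head p q pq≈0 n = begin
  coeff (p *ₚ q) n                             ≡⟨ ℚₚ.+-identityˡ _ ⟨
  0ℚ ℚ.+ coeff (p *ₚ q) n                      ≡⟨ cong (ℚ._+ coeff (p *ₚ q) n) (ℚₚ.*-zeroˡ (coeff q (suc n))) ⟨
  0ℚ ℚ.* coeff q (suc n) ℚ.+ coeff (p *ₚ q) n  ≡⟨ coeff-*-suc 0ℚ p q n ⟨
  coeff ((0ℚ ∷ p) *ₚ q) (suc n)                ≡⟨ pq≈0 (suc n) ⟩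
  0ℚ                                           ∎
  where open ≡-Reasoning

*-zero-divisor : ∀ p q → p *ₚ q ≈ₚ [] → p ≈ₚ [] ⊎ q ≈ₚ []
*-zero-divisor []      q pq≈0 = inj₁ λ _ → refl
*-zero-divisor (c ∷ p) q pq≈0 with c ≟ 0ℚ
... | no  c≢0  = inj₂ (*-cancel-unit c p q c≢0 pq≈0)
... | yes refl with *-zero-divisor p q (*-zero-head p q pq≈0)
...   | inj₁ p≈0 = inj₁ λ { zero → refl ; (suc n) → p≈0 n }
...   | inj₂ q≈0 = inj₂ q≈0

*-nonZeroₚ : ∀ {p q} → NonZeroₚ p → NonZeroₚ q → NonZeroₚ (p *ₚ q)
*-nonZeroₚ {p} {q} p≉0 q≉0 pq≈0 = [ p≉0 , q≉0 ]′ (*-zero-divisor p q pq≈0)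

-- A fraction of polynomials, not necessarily in lowest terms; the field ℚ(k)
-- is RatFun modulo _≃_.
record RatFun : Set where
  constructor mkRatFun
  field
    num         : Poly
    den         : Poly
    den-nonZero : NonZeroₚ den

open RatFun

_≃_ : RatFun → RatFun → Set
f ≃ g = num f *ₚ den g ≈ₚ num g *ₚ den f

NonZero : RatFun → Set
NonZero f = NonZeroₚ (num f)

poly : Poly → RatFun
poly p = mkRatFun p (1 ∷ []) (λ 1≈0 → contradiction (1≈0 0) λ ())

_*_ : RatFun → RatFun → RatFun
f * g = mkRatFun (num f *ₚ num g) (den f *ₚ den g)
                 (*-nonZeroₚ {den f} (den-nonZero f) (den-nonZero g))

inv : (f : RatFun) → NonZero f → RatFun
inv f f≄0 = mkRatFun (den f) (num f) f≄0

_^ⁿ_ : RatFun → ℕ → RatFun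
f ^ⁿ zero  = poly (1 ∷ [])
f ^ⁿ suc n = f * f ^ⁿ n

^ⁿ-nonZero : ∀ f n → NonZero f → NonZero (f ^ⁿ n)
^ⁿ-nonZero f zero    f≄0 = den-nonZero (poly [])
^ⁿ-nonZero f (suc n) f≄0 = *-nonZeroₚ {num f} f≄0 (^ⁿ-nonZero f n f≄0)

_^⟨_⟩_ : (f : RatFun) → NonZero f → ℤ → RatFun
f ^⟨ f≄0 ⟩ (+ n)    = f ^ⁿ n
f ^⟨ f≄0 ⟩ -[1+ n ] = inv (f ^ⁿ suc n) (^ⁿ-nonZero f (suc n) f≄0)

^-nonZero : ∀ f (f≄0 : NonZero f) z → NonZero (f ^⟨ f≄0 ⟩ z)
^-nonZero f f≄0 (+ n)    = ^ⁿ-nonZero f n f≄0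
^-nonZero f f≄0 -[1+ n ] = den-nonZero (f ^ⁿ suc n)

_′ : RatFun → RatFun
f ′ = mkRatFun (derivₚ (num f) *ₚ den f -ₚ num f *ₚ derivₚ (den f))
               (den f *ₚ den f)
               (*-nonZeroₚ {den f} (den-nonZero f) (den-nonZero f))

k 1-k² 1+k-k² 1-4k-k² : RatFun
k       = poly (0 ∷ 1 ∷ [])
1-k²    = poly (1 ∷ 0 ∷ -1 ∷ [])
1+k-k²  = poly (1 ∷ 1 ∷ -1 ∷ [])
1-4k-k² = poly (1 ∷ -4 ∷ -1 ∷ [])

k≄0 : NonZero k
k≄0 p≈0 = contradiction (p≈0 1) λ ()

1-k²≄0 : NonZero 1-k²
1-k²≄0 p≈0 = contradiction (p≈0 0) λ ()

1+k-k²≄0 : NonZero 1+k-k²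
1+k-k²≄0 p≈0 = contradiction (p≈0 0) λ ()

1-4k-k²≄0 : NonZero 1-4k-k²
1-4k-k²≄0 p≈0 = contradiction (p≈0 0) λ ()

integrand : ℤ → ℤ → ℤ → RatFun
integrand a₁ a₂ a₃ = numerator * inv denominator (^-nonZero k k≄0 e)
  where
  e : ℤ
  e = a₁ ℤ.+ a₂ ℤ.+ a₃ ℤ.+ 1

  numerator denominator : RatFun
  numerator   = 1-k²    ^⟨ 1-k²≄0    ⟩ a₁
              * 1+k-k²  ^⟨ 1+k-k²≄0  ⟩ a₂
              * 1-4k-k² ^⟨ 1-4k-k²≄0 ⟩ a₃
  denominator = k ^⟨ k≄0 ⟩ e

twelveTriples : List (ℤ × ℤ × ℤ)
twelveTriples =
    ( 0 , -2 ,  1) ∷ ( 1 ,  0 ,  0) ∷ (-2 ,  0 ,  0) ∷ ( 0 ,  1 , -2)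
  ∷ ( 1 , -4 ,  0) ∷ ( 0 ,  2 ,  1) ∷ (-4 ,  1 ,  2) ∷ ( 2 ,  0 , -4)
  ∷ ( 0 , -5 ,  1) ∷ ( 1 ,  3 ,  0) ∷ (-5 ,  0 ,  3) ∷ ( 3 ,  1 , -5)
  ∷ []

familyTriples : ℕ → List (ℤ × ℤ × ℤ)
familyTriples m =
    (0 , -2m-2 , 2m+1) ∷ (2m+1 , 0 , 0) ∷ (-2m-2 , 0 , 0) ∷ (0 , 2m+1 , -2m-2)
  ∷ []
  where
  2m+1 -2m-2 : ℤ
  2m+1  = 2 ℤ.* + m ℤ.+ 1
  -2m-2 = -2 ℤ.* + m ℤ.- 2

{-# OPTIONS --safe #-}

-- The four families are the integrals of A²ᵐ⁺¹ / B²ᵐ⁺² for A and B two of the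
-- quadratics k, 1-k², 1+k-k², 1-4k-k² whose root pairs are harmonic conjugates.
-- Then there are C (a multiple of the Jacobian of A and B) and a constant γ with
--   (C/B)′ = A/B²   and   C(A′B - AB′) = A² + γB²,
-- and differentiating (C/B)(A/B)²ᵐ⁺² reduces ∫ A²ᵐ⁺³/B²ᵐ⁺⁴ to ∫ A²ᵐ⁺¹/B²ᵐ⁺².
-- Each of the twelve triples has an explicit antiderivative N / (d Bⁿ), found by
-- undetermined coefficients.
module Submission where

open import Defs
open import Agda.Builtin.FromNat using (fromNat)
open import Agda.Builtin.FromNeg using (fromNeg)
open import Algebra.Bundles using (CommutativeMonoid; CommutativeRing)
open import Data.Integer.Base as ℤ using (ℤ; +_; -[1+_])
import Data.Integer.Properties as ℤₚ
open import Data.List.Base as List using (List; []; _∷_)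
open import Data.List.Membership.Propositional using (_∈_)
open import Data.List.Relation.Unary.All as All using (All; []; _∷_)
open import Data.Nat.Base as ℕ using (ℕ; zero; suc)
import Data.Nat.Properties as ℕₚ
open import Data.Product.Base using (∃; _×_; _,_)
open import Data.Rational.Base as ℚ using (ℚ; 0ℚ; 1ℚ)
import Data.Rational.Properties as ℚₚ
open import Algebra.Properties.CommutativeSemigroup
  (CommutativeMonoid.commutativeSemigroup ℚₚ.+-0-commutativeMonoid) using (interchange)
open import Algebra.Properties.CommutativeSemigroup
  (CommutativeMonoid.commutativeSemigroup ℚₚ.*-1-commutativeMonoid) using (x∙yz≈y∙xz)
open import Data.Rational.Literals using (fromℤ)
open import Data.Rational.Unnormalised.Base using (*≡*)
import Data.Rational.Unnormalised.Properties as ℚᵘₚ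
open import Data.Sum.Base using (_⊎_; inj₁; inj₂)
open import Data.Unit.Base using (tt)
open import Level using (0ℓ)
open import Relation.Binary.Bundles using (Setoid)
open import Relation.Binary.Definitions using (Decidable)
open import Relation.Binary.PropositionalEquality
import Relation.Binary.Reasoning.Setoid as ≈-Reasoning
open import Relation.Nullary.Decidable using (True; yes; map′; _×-dec_; dec⇒maybe; toWitness)
open import Tactic.RingSolver.Core.AlmostCommutativeRing using (fromCommutativeRing)
import Tactic.RingSolver.NonReflective as RingSolver

open RatFun

-- Polynomials over ℚ, up to equality of coefficients, as a commutative ring.

-- _≈ₚ_ unfolds to an equation between coefficients, from which the polynomials
-- cannot be inferred; wrapped in a record they can.
infix 4 _≋_
record _≋_ (p q : Poly) : Set where
  field
    at : p ≈ₚ q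

open _≋_

≋-setoid : Setoid 0ℓ 0ℓ
≋-setoid = record
  { Carrier = Poly
  ; _≈_ = _≋_
  ; isEquivalence = record
    { refl  = λ where .at _ → refl
    ; sym   = λ p≋q → λ where .at n → sym (at p≋q n)
    ; trans = λ p≋q q≋r → λ where .at n → trans (at p≋q n) (at q≋r n)
    }
  }

module ≋ where
  open Setoid ≋-setoid public using (refl; sym; trans; reflexive)

∷-cong : ∀ {c d p q} → c ≡ d → p ≋ q → c ∷ p ≋ d ∷ q
∷-cong c≡d p≋q .at zero    = c≡d
∷-cong c≡d p≋q .at (suc n) = at p≋q n

+ₚ-cong : ∀ {p q r s} → p ≋ q → r ≋ s → p +ₚ r ≋ q +ₚ s
+ₚ-cong {p} {q} {r} {s} p≋q r≋s .at n = begin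
  coeff (p +ₚ r) n            ≡⟨ coeff-+ p r n ⟩
  coeff p n ℚ.+ coeff r n     ≡⟨ cong₂ ℚ._+_ (at p≋q n) (at r≋s n) ⟩
  coeff q n ℚ.+ coeff s n     ≡⟨ coeff-+ q s n ⟨
  coeff (q +ₚ s) n            ∎
  where open ≡-Reasoning

+ₚ-congˡ : ∀ p {q r} → q ≋ r → p +ₚ q ≋ p +ₚ r
+ₚ-congˡ p q≋r = +ₚ-cong (≋.refl {p}) q≋r

+ₚ-assoc : ∀ p q r → (p +ₚ q) +ₚ r ≋ p +ₚ (q +ₚ r)
+ₚ-assoc p q r .at n = begin
  coeff ((p +ₚ q) +ₚ r) n                        ≡⟨ coeff-+ (p +ₚ q) r n ⟩
  coeff (p +ₚ q) n ℚ.+ coeff r n                 ≡⟨ cong (ℚ._+ coeff r n) (coeff-+ p q n) ⟩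
  coeff p n ℚ.+ coeff q n ℚ.+ coeff r n          ≡⟨ ℚₚ.+-assoc (coeff p n) _ _ ⟩
  coeff p n ℚ.+ (coeff q n ℚ.+ coeff r n)        ≡⟨ cong (coeff p n ℚ.+_) (coeff-+ q r n) ⟨
  coeff p n ℚ.+ coeff (q +ₚ r) n                 ≡⟨ coeff-+ p (q +ₚ r) n ⟨
  coeff (p +ₚ (q +ₚ r)) n                        ∎
  where open ≡-Reasoning

+ₚ-comm : ∀ p q → p +ₚ q ≋ q +ₚ p
+ₚ-comm p q .at n = begin
  coeff (p +ₚ q) n            ≡⟨ coeff-+ p q n ⟩
  coeff p n ℚ.+ coeff q n     ≡⟨ ℚₚ.+-comm (coeff p n) _ ⟩
  coeff q n ℚ.+ coeff p n     ≡⟨ coeff-+ q p n ⟨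
  coeff (q +ₚ p) n            ∎
  where open ≡-Reasoning

+ₚ-identityʳ : ∀ p → p +ₚ [] ≋ p
+ₚ-identityʳ []      = ≋.refl
+ₚ-identityʳ (c ∷ p) = ≋.refl

+ₚ-inverseʳ : ∀ p → p -ₚ p ≋ []
+ₚ-inverseʳ p .at n = begin
  coeff (p -ₚ p) n                       ≡⟨ coeff-+ p _ n ⟩
  coeff p n ℚ.+ coeff (scale -1 p) n     ≡⟨ cong (coeff p n ℚ.+_) (coeff-scale -1 p n) ⟩
  coeff p n ℚ.+ -1 ℚ.* coeff p n         ≡⟨ cong (coeff p n ℚ.+_) (ℚₚ.neg-distribˡ-* 1ℚ (coeff p n)) ⟨
  coeff p n ℚ.- 1ℚ ℚ.* coeff p n         ≡⟨ cong (λ c → coeff p n ℚ.- c) (ℚₚ.*-identityˡ (coeff p n)) ⟩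
  coeff p n ℚ.- coeff p n                ≡⟨ ℚₚ.+-inverseʳ (coeff p n) ⟩
  0ℚ                                     ∎
  where open ≡-Reasoning

scale-congˡ : ∀ c {p q} → p ≋ q → scale c p ≋ scale c q
scale-congˡ c {p} {q} p≋q .at n = begin
  coeff (scale c p) n    ≡⟨ coeff-scale c p n ⟩
  c ℚ.* coeff p n        ≡⟨ cong (c ℚ.*_) (at p≋q n) ⟩
  c ℚ.* coeff q n        ≡⟨ coeff-scale c q n ⟨
  coeff (scale c q) n    ∎
  where open ≡-Reasoning

scale-distrib-+ₚ : ∀ c p q → scale c (p +ₚ q) ≋ scale c p +ₚ scale c q
scale-distrib-+ₚ c p q .at n = begin
  coeff (scale c (p +ₚ q)) n                       ≡⟨ coeff-scale c (p +ₚ q) n ⟩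
  c ℚ.* coeff (p +ₚ q) n                           ≡⟨ cong (c ℚ.*_) (coeff-+ p q n) ⟩
  c ℚ.* (coeff p n ℚ.+ coeff q n)                  ≡⟨ ℚₚ.*-distribˡ-+ c _ _ ⟩
  c ℚ.* coeff p n ℚ.+ c ℚ.* coeff q n              ≡⟨ cong₂ ℚ._+_ (coeff-scale c p n) (coeff-scale c q n) ⟨
  coeff (scale c p) n ℚ.+ coeff (scale c q) n      ≡⟨ coeff-+ (scale c p) (scale c q) n ⟨
  coeff (scale c p +ₚ scale c q) n                 ∎
  where open ≡-Reasoning

scale-scale : ∀ c d p → scale (c ℚ.* d) p ≋ scale c (scale d p)
scale-scale c d p .at n = begin
  coeff (scale (c ℚ.* d) p) n      ≡⟨ coeff-scale (c ℚ.* d) p n ⟩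
  c ℚ.* d ℚ.* coeff p n            ≡⟨ ℚₚ.*-assoc c d _ ⟩
  c ℚ.* (d ℚ.* coeff p n)          ≡⟨ cong (c ℚ.*_) (coeff-scale d p n) ⟨
  c ℚ.* coeff (scale d p) n        ≡⟨ coeff-scale c (scale d p) n ⟨
  coeff (scale c (scale d p)) n    ∎
  where open ≡-Reasoning

scale-zero : ∀ p → scale 0 p ≋ []
scale-zero p .at n = trans (coeff-scale 0 p n) (ℚₚ.*-zeroˡ (coeff p n))

scale-one : ∀ p → scale 1 p ≋ p
scale-one p .at n = trans (coeff-scale 1 p n) (ℚₚ.*-identityˡ (coeff p n))

+ₚ-interchange : ∀ p q r s → (p +ₚ q) +ₚ (r +ₚ s) ≋ (p +ₚ r) +ₚ (q +ₚ s)
+ₚ-interchange p q r s .at n = begin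
  coeff ((p +ₚ q) +ₚ (r +ₚ s)) n
    ≡⟨ coeff-+ (p +ₚ q) (r +ₚ s) n ⟩
  coeff (p +ₚ q) n ℚ.+ coeff (r +ₚ s) n
    ≡⟨ cong₂ ℚ._+_ (coeff-+ p q n) (coeff-+ r s n) ⟩
  (coeff p n ℚ.+ coeff q n) ℚ.+ (coeff r n ℚ.+ coeff s n)
    ≡⟨ interchange (coeff p n) _ _ _ ⟩
  (coeff p n ℚ.+ coeff r n) ℚ.+ (coeff q n ℚ.+ coeff s n)
    ≡⟨ cong₂ ℚ._+_ (coeff-+ p r n) (coeff-+ q s n) ⟨
  coeff (p +ₚ r) n ℚ.+ coeff (q +ₚ s) n
    ≡⟨ coeff-+ (p +ₚ r) (q +ₚ s) n ⟨
  coeff ((p +ₚ r) +ₚ (q +ₚ s)) n ∎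
  where open ≡-Reasoning

0∷-distrib-+ₚ : ∀ p q → 0 ∷ (p +ₚ q) ≋ (0 ∷ p) +ₚ (0 ∷ q)
0∷-distrib-+ₚ p q = ∷-cong (sym (ℚₚ.+-identityˡ 0)) ≋.refl

scale-∷ : ∀ c p → scale c (0 ∷ p) ≋ 0 ∷ scale c p
scale-∷ c p = ∷-cong (ℚₚ.*-zeroʳ c) ≋.refl

*ₚ-congˡ : ∀ p {q r} → q ≋ r → p *ₚ q ≋ p *ₚ r
*ₚ-congˡ []      q≋r = ≋.refl
*ₚ-congˡ (c ∷ p) q≋r = +ₚ-cong (scale-congˡ c q≋r) (∷-cong refl (*ₚ-congˡ p q≋r))

*ₚ-zeroʳ : ∀ p → p *ₚ [] ≋ []
*ₚ-zeroʳ []      = ≋.refl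
*ₚ-zeroʳ (c ∷ p) .at zero    = refl
*ₚ-zeroʳ (c ∷ p) .at (suc n) = at (*ₚ-zeroʳ p) n

*ₚ-distribˡ-+ₚ : ∀ p q r → p *ₚ (q +ₚ r) ≋ p *ₚ q +ₚ p *ₚ r
*ₚ-distribˡ-+ₚ []      q r = ≋.refl
*ₚ-distribˡ-+ₚ (c ∷ p) q r = begin
  scale c (q +ₚ r) +ₚ (0 ∷ p *ₚ (q +ₚ r))
    ≈⟨ +ₚ-cong (scale-distrib-+ₚ c q r)
         (≋.trans (∷-cong refl (*ₚ-distribˡ-+ₚ p q r)) (0∷-distrib-+ₚ (p *ₚ q) _)) ⟩
  (scale c q +ₚ scale c r) +ₚ ((0 ∷ p *ₚ q) +ₚ (0 ∷ p *ₚ r))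
    ≈⟨ +ₚ-interchange (scale c q) _ _ _ ⟩
  (c ∷ p) *ₚ q +ₚ (c ∷ p) *ₚ r ∎
  where open ≈-Reasoning ≋-setoid

*ₚ-constʳ : ∀ p c → p *ₚ (c ∷ []) ≋ scale c p
*ₚ-constʳ []      c = ≋.refl
*ₚ-constʳ (d ∷ p) c = ∷-cong (trans (ℚₚ.+-identityʳ _) (ℚₚ.*-comm d c)) (*ₚ-constʳ p c)

*ₚ-0∷ : ∀ p q → p *ₚ (0 ∷ q) ≋ 0 ∷ p *ₚ q
*ₚ-0∷ p q .at zero    = *-shift-zero p q
*ₚ-0∷ p q .at (suc n) = *-shift-suc p q n

-- The defining recursion of `_*ₚ_` mirrored to the right factor: split `c ∷ q` as c + kq and
-- distribute. Commutativity is then an induction that matches the two recursions.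
*ₚ-∷ : ∀ p c q → p *ₚ (c ∷ q) ≋ scale c p +ₚ (0 ∷ p *ₚ q)
*ₚ-∷ p c q = begin
  p *ₚ (c ∷ q)                      ≈⟨ *ₚ-congˡ p (∷-cong (sym (ℚₚ.+-identityʳ c)) ≋.refl) ⟩
  p *ₚ ((c ∷ []) +ₚ (0 ∷ q))        ≈⟨ *ₚ-distribˡ-+ₚ p _ _ ⟩
  p *ₚ (c ∷ []) +ₚ p *ₚ (0 ∷ q)     ≈⟨ +ₚ-cong (*ₚ-constʳ p c) (*ₚ-0∷ p q) ⟩
  scale c p +ₚ (0 ∷ p *ₚ q)         ∎
  where open ≈-Reasoning ≋-setoid

*ₚ-comm : ∀ p q → p *ₚ q ≋ q *ₚ p
*ₚ-comm []      q = ≋.sym (*ₚ-zeroʳ q)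
*ₚ-comm (c ∷ p) q = begin
  scale c q +ₚ (0 ∷ p *ₚ q)   ≈⟨ +ₚ-congˡ (scale c q) (∷-cong refl (*ₚ-comm p q)) ⟩
  scale c q +ₚ (0 ∷ q *ₚ p)   ≈⟨ *ₚ-∷ q c p ⟨
  q *ₚ (c ∷ p)                ∎
  where open ≈-Reasoning ≋-setoid

-- `_*ₚ_` recurses on the list of its left factor, and equal polynomials may be lists of different
-- lengths. Commutativity carries a change of the left factor over to `*ₚ-congˡ`.
*ₚ-cong : ∀ {p q r s} → p ≋ q → r ≋ s → p *ₚ r ≋ q *ₚ s
*ₚ-cong {p} {q} {r} {s} p≋q r≋s = begin
  p *ₚ r   ≈⟨ *ₚ-comm p r ⟩
  r *ₚ p   ≈⟨ *ₚ-congˡ r p≋q ⟩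
  r *ₚ q   ≈⟨ *ₚ-comm r q ⟩
  q *ₚ r   ≈⟨ *ₚ-congˡ q r≋s ⟩
  q *ₚ s   ∎
  where open ≈-Reasoning ≋-setoid

*ₚ-congʳ : ∀ p {q r} → q ≋ r → q *ₚ p ≋ r *ₚ p
*ₚ-congʳ p q≋r = *ₚ-cong q≋r (≋.refl {p})

*ₚ-distribʳ-+ₚ : ∀ p q r → (q +ₚ r) *ₚ p ≋ q *ₚ p +ₚ r *ₚ p
*ₚ-distribʳ-+ₚ p q r = begin
  (q +ₚ r) *ₚ p        ≈⟨ *ₚ-comm (q +ₚ r) p ⟩
  p *ₚ (q +ₚ r)        ≈⟨ *ₚ-distribˡ-+ₚ p q r ⟩
  p *ₚ q +ₚ p *ₚ r     ≈⟨ +ₚ-cong (*ₚ-comm p q) (*ₚ-comm p r) ⟩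
  q *ₚ p +ₚ r *ₚ p     ∎
  where open ≈-Reasoning ≋-setoid

0∷-*ₚ : ∀ p q → (0 ∷ p) *ₚ q ≋ 0 ∷ p *ₚ q
0∷-*ₚ p q = +ₚ-cong (scale-zero q) ≋.refl

scale-*ₚ : ∀ c p q → scale c p *ₚ q ≋ scale c (p *ₚ q)
scale-*ₚ c []      q = ≋.refl
scale-*ₚ c (d ∷ p) q = begin
  scale (c ℚ.* d) q +ₚ (0 ∷ scale c p *ₚ q)
    ≈⟨ +ₚ-cong (scale-scale c d q) (∷-cong refl (scale-*ₚ c p q)) ⟩
  scale c (scale d q) +ₚ (0 ∷ scale c (p *ₚ q))
    ≈⟨ +ₚ-congˡ (scale c (scale d q)) (scale-∷ c (p *ₚ q)) ⟨
  scale c (scale d q) +ₚ scale c (0 ∷ p *ₚ q)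
    ≈⟨ scale-distrib-+ₚ c (scale d q) _ ⟨
  scale c ((d ∷ p) *ₚ q) ∎
  where open ≈-Reasoning ≋-setoid

*ₚ-assoc : ∀ p q r → (p *ₚ q) *ₚ r ≋ p *ₚ (q *ₚ r)
*ₚ-assoc []      q r = ≋.refl
*ₚ-assoc (c ∷ p) q r = begin
  (scale c q +ₚ (0 ∷ p *ₚ q)) *ₚ r         ≈⟨ *ₚ-distribʳ-+ₚ r (scale c q) _ ⟩
  scale c q *ₚ r +ₚ (0 ∷ p *ₚ q) *ₚ r      ≈⟨ +ₚ-cong (scale-*ₚ c q r) (0∷-*ₚ (p *ₚ q) r) ⟩
  scale c (q *ₚ r) +ₚ (0 ∷ (p *ₚ q) *ₚ r)  ≈⟨ +ₚ-congˡ (scale c (q *ₚ r)) (∷-cong refl (*ₚ-assoc p q r)) ⟩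
  (c ∷ p) *ₚ (q *ₚ r)                      ∎
  where open ≈-Reasoning ≋-setoid

*ₚ-identityˡ : ∀ p → (1 ∷ []) *ₚ p ≋ p
*ₚ-identityˡ p = begin
  scale 1 p +ₚ (0 ∷ [])   ≈⟨ +ₚ-cong (scale-one p) (λ where .at zero → refl ; .at (suc _) → refl) ⟩
  p +ₚ []                 ≈⟨ +ₚ-identityʳ p ⟩
  p                       ∎
  where open ≈-Reasoning ≋-setoid

*ₚ-identityʳ : ∀ p → p *ₚ (1 ∷ []) ≋ p
*ₚ-identityʳ p = ≋.trans (*ₚ-constʳ p 1) (scale-one p)

polyRing : CommutativeRing 0ℓ 0ℓ
polyRing = record
  { Carrier = Poly
  ; _≈_ = _≋_
  ; _+_ = _+ₚ_
  ; _*_ = _*ₚ_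
  ; -_  = scale -1
  ; 0#  = []
  ; 1#  = 1 ∷ []
  ; isCommutativeRing = record
    { isRing = record
      { +-isAbelianGroup = record
        { isGroup = record
          { isMonoid = record
            { isSemigroup = record
              { isMagma = record
                { isEquivalence = Setoid.isEquivalence ≋-setoid
                ; ∙-cong = +ₚ-cong
                }
              ; assoc = +ₚ-assoc
              }
            ; identity = (λ _ → ≋.refl) , +ₚ-identityʳ
            }
          ; inverse = (λ p → ≋.trans (+ₚ-comm (scale -1 p) p) (+ₚ-inverseʳ p)) , +ₚ-inverseʳ
          ; ⁻¹-cong = scale-congˡ -1
          }
        ; comm = +ₚ-comm
        }
      ; *-cong = *ₚ-cong
      ; *-assoc = *ₚ-assoc
      ; *-identity = *ₚ-identityˡ , *ₚ-identityʳ
      ; distrib = *ₚ-distribˡ-+ₚ , *ₚ-distribʳ-+ₚ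
      }
    ; *-comm = *ₚ-comm
    }
  }

-- The formal derivative and the Leibniz rule.

-- Addition in ℚ normalises its result and does not compute for a variable `n`. In the unnormalised
-- rationals the claim is an integer equation obtained by cross-multiplication.
fromNat-suc : ∀ n → fromℤ (+ suc n) ≡ 1ℚ ℚ.+ fromℤ (+ n)
fromNat-suc n = ℚₚ.toℚᵘ-injective (ℚᵘₚ.≃-trans
  (*≡* (cong (λ i → (+ 1 ℤ.+ i) ℤ.* + 1) (sym (ℤₚ.*-identityʳ (+ n)))))
  (ℚᵘₚ.≃-sym (ℚₚ.toℚᵘ-homo-+ 1ℚ (fromℤ (+ n)))))

coeff-scaleFrom : ∀ m p n → coeff (scaleFrom m p) n ≡ fromNat (m ℕ.+ n) ℚ.* coeff p n
coeff-scaleFrom m []      n       = sym (ℚₚ.*-zeroʳ (fromNat (m ℕ.+ n)))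
coeff-scaleFrom m (c ∷ p) zero    = cong (λ i → fromNat i ℚ.* c) (sym (ℕₚ.+-identityʳ m))
coeff-scaleFrom m (c ∷ p) (suc n) =
  trans (coeff-scaleFrom (suc m) p n) (cong (λ i → fromNat i ℚ.* coeff p n) (sym (ℕₚ.+-suc m n)))

coeff-derivₚ : ∀ p n → coeff (derivₚ p) n ≡ fromNat (suc n) ℚ.* coeff p (suc n)
coeff-derivₚ []      n = sym (ℚₚ.*-zeroʳ (fromNat (suc n)))
coeff-derivₚ (c ∷ p) n = coeff-scaleFrom 1 p n

derivₚ-cong : ∀ {p q} → p ≋ q → derivₚ p ≋ derivₚ q
derivₚ-cong {p} {q} p≋q .at n = begin
  coeff (derivₚ p) n                       ≡⟨ coeff-derivₚ p n ⟩
  fromNat (suc n) ℚ.* coeff p (suc n)      ≡⟨ cong (fromNat (suc n) ℚ.*_) (at p≋q (suc n)) ⟩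
  fromNat (suc n) ℚ.* coeff q (suc n)      ≡⟨ coeff-derivₚ q n ⟨
  coeff (derivₚ q) n                       ∎
  where open ≡-Reasoning

derivₚ-+ₚ : ∀ p q → derivₚ (p +ₚ q) ≋ derivₚ p +ₚ derivₚ q
derivₚ-+ₚ p q .at n = begin
  coeff (derivₚ (p +ₚ q)) n
    ≡⟨ coeff-derivₚ (p +ₚ q) n ⟩
  fromNat (suc n) ℚ.* coeff (p +ₚ q) (suc n)
    ≡⟨ cong (fromNat (suc n) ℚ.*_) (coeff-+ p q (suc n)) ⟩
  fromNat (suc n) ℚ.* (coeff p (suc n) ℚ.+ coeff q (suc n))
    ≡⟨ ℚₚ.*-distribˡ-+ (fromNat (suc n)) (coeff p (suc n)) (coeff q (suc n)) ⟩
  fromNat (suc n) ℚ.* coeff p (suc n) ℚ.+ fromNat (suc n) ℚ.* coeff q (suc n)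
    ≡⟨ cong₂ ℚ._+_ (coeff-derivₚ p n) (coeff-derivₚ q n) ⟨
  coeff (derivₚ p) n ℚ.+ coeff (derivₚ q) n
    ≡⟨ coeff-+ (derivₚ p) (derivₚ q) n ⟨
  coeff (derivₚ p +ₚ derivₚ q) n ∎
  where open ≡-Reasoning

derivₚ-scale : ∀ c p → derivₚ (scale c p) ≋ scale c (derivₚ p)
derivₚ-scale c p .at n = begin
  coeff (derivₚ (scale c p)) n
    ≡⟨ coeff-derivₚ (scale c p) n ⟩
  fromNat (suc n) ℚ.* coeff (scale c p) (suc n)
    ≡⟨ cong (fromNat (suc n) ℚ.*_) (coeff-scale c p (suc n)) ⟩
  fromNat (suc n) ℚ.* (c ℚ.* coeff p (suc n))
    ≡⟨ x∙yz≈y∙xz (fromNat (suc n)) c (coeff p (suc n)) ⟩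
  c ℚ.* (fromNat (suc n) ℚ.* coeff p (suc n))
    ≡⟨ cong (c ℚ.*_) (coeff-derivₚ p n) ⟨
  c ℚ.* coeff (derivₚ p) n
    ≡⟨ coeff-scale c (derivₚ p) n ⟨
  coeff (scale c (derivₚ p)) n ∎
  where open ≡-Reasoning

-- This is (c + kp)′ = p + kp′. It replaces the running index of `scaleFrom` by a recursion on which
-- the product rule can be proved by induction.
derivₚ-∷ : ∀ c p → derivₚ (c ∷ p) ≋ p +ₚ (0 ∷ derivₚ p)
derivₚ-∷ c p .at zero = begin
  coeff (scaleFrom 1 p) 0          ≡⟨ coeff-scaleFrom 1 p 0 ⟩
  1ℚ ℚ.* coeff p 0                 ≡⟨ ℚₚ.*-identityˡ (coeff p 0) ⟩
  coeff p 0                        ≡⟨ ℚₚ.+-identityʳ (coeff p 0) ⟨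
  coeff p 0 ℚ.+ 0ℚ                 ≡⟨ coeff-+ p (0 ∷ derivₚ p) 0 ⟨
  coeff (p +ₚ (0 ∷ derivₚ p)) 0    ∎
  where open ≡-Reasoning
derivₚ-∷ c p .at (suc n) = begin
  coeff (scaleFrom 1 p) (suc n)
    ≡⟨ coeff-scaleFrom 1 p (suc n) ⟩
  fromNat (suc (suc n)) ℚ.* coeff p (suc n)
    ≡⟨ cong (ℚ._* coeff p (suc n)) (fromNat-suc (suc n)) ⟩
  (1ℚ ℚ.+ fromNat (suc n)) ℚ.* coeff p (suc n)
    ≡⟨ ℚₚ.*-distribʳ-+ (coeff p (suc n)) 1ℚ (fromNat (suc n)) ⟩
  1ℚ ℚ.* coeff p (suc n) ℚ.+ fromNat (suc n) ℚ.* coeff p (suc n)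
    ≡⟨ cong₂ ℚ._+_ (ℚₚ.*-identityˡ (coeff p (suc n))) (sym (coeff-derivₚ p n)) ⟩
  coeff p (suc n) ℚ.+ coeff (derivₚ p) n
    ≡⟨ coeff-+ p (0 ∷ derivₚ p) (suc n) ⟨
  coeff (p +ₚ (0 ∷ derivₚ p)) (suc n) ∎
  where open ≡-Reasoning

-- Induction on `p`: with c + kp in place of `c ∷ p`, the product is cq + k(pq), and the induction
-- hypothesis gives (pq)′. The remaining steps regroup the sum.
derivₚ-*ₚ : ∀ p q → derivₚ (p *ₚ q) ≋ derivₚ p *ₚ q +ₚ p *ₚ derivₚ q
derivₚ-*ₚ []      q = ≋.refl
derivₚ-*ₚ (c ∷ p) q = begin
  derivₚ (scale c q +ₚ (0 ∷ p *ₚ q))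
    ≈⟨ derivₚ-+ₚ (scale c q) _ ⟩
  derivₚ (scale c q) +ₚ derivₚ (0 ∷ p *ₚ q)
    ≈⟨ +ₚ-cong (derivₚ-scale c q) (derivₚ-∷ 0 (p *ₚ q)) ⟩
  scale c (derivₚ q) +ₚ (p *ₚ q +ₚ (0 ∷ derivₚ (p *ₚ q)))
    ≈⟨ +ₚ-congˡ (scale c (derivₚ q)) (+ₚ-congˡ (p *ₚ q)
         (≋.trans (∷-cong refl (derivₚ-*ₚ p q)) (0∷-distrib-+ₚ (derivₚ p *ₚ q) _))) ⟩
  scale c (derivₚ q) +ₚ (p *ₚ q +ₚ ((0 ∷ derivₚ p *ₚ q) +ₚ (0 ∷ p *ₚ derivₚ q)))
    ≈⟨ +ₚ-congˡ (scale c (derivₚ q)) (+ₚ-assoc (p *ₚ q) _ _) ⟨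
  scale c (derivₚ q) +ₚ ((p *ₚ q +ₚ (0 ∷ derivₚ p *ₚ q)) +ₚ (0 ∷ p *ₚ derivₚ q))
    ≈⟨ x∙yz≈y∙xz′ (scale c (derivₚ q)) (p *ₚ q +ₚ (0 ∷ derivₚ p *ₚ q)) (0 ∷ p *ₚ derivₚ q) ⟩
  (p *ₚ q +ₚ (0 ∷ derivₚ p *ₚ q)) +ₚ (c ∷ p) *ₚ derivₚ q
    ≈⟨ +ₚ-cong (+ₚ-congˡ (p *ₚ q) (0∷-*ₚ (derivₚ p) q)) ≋.refl ⟨
  (p *ₚ q +ₚ (0 ∷ derivₚ p) *ₚ q) +ₚ (c ∷ p) *ₚ derivₚ q
    ≈⟨ +ₚ-cong (*ₚ-distribʳ-+ₚ q p _) ≋.refl ⟨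
  (p +ₚ (0 ∷ derivₚ p)) *ₚ q +ₚ (c ∷ p) *ₚ derivₚ q
    ≈⟨ +ₚ-cong (*ₚ-congʳ q (derivₚ-∷ c p)) ≋.refl ⟨
  derivₚ (c ∷ p) *ₚ q +ₚ (c ∷ p) *ₚ derivₚ q ∎
  where
  open ≈-Reasoning ≋-setoid
  open import Algebra.Properties.CommutativeSemigroup
    (CommutativeMonoid.commutativeSemigroup (CommutativeRing.+-commutativeMonoid polyRing))
    using () renaming (x∙yz≈y∙xz to x∙yz≈y∙xz′)

-- Deciding polynomial identities, and the ring solver.

infix 4 _≋?_
-- Trailing zeros are allowed, so a list that outlasts the other is compared with zeros. Identities
-- between explicit polynomials are later proved by evaluating this test.
_≋?_ : Decidable _≋_
[]      ≋? []      = yes ≋.refl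
[]      ≋? (d ∷ q) = map′ (λ { (0≡d , 0≋q) → λ where .at zero → 0≡d ; .at (suc n) → at 0≋q n })
                          (λ 0≋q → at 0≋q 0 , λ where .at n → at 0≋q (suc n))
                          ((0ℚ ℚₚ.≟ d) ×-dec ([] ≋? q))
(c ∷ p) ≋? []      = map′ (λ { (c≡0 , p≋0) → λ where .at zero → c≡0 ; .at (suc n) → at p≋0 n })
                          (λ p≋0 → at p≋0 0 , λ where .at n → at p≋0 (suc n))
                          ((c ℚₚ.≟ 0ℚ) ×-dec (p ≋? []))
(c ∷ p) ≋? (d ∷ q) = map′ (λ { (c≡d , p≋q) → ∷-cong c≡d p≋q })
                          (λ p≋q → at p≋q 0 , λ where .at n → at p≋q (suc n))
                          ((c ℚₚ.≟ d) ×-dec (p ≋? q))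

private
  -- The solver takes polynomials themselves as coefficients; the test against `[]` lets it
  -- recognise coefficients that vanish.
  open module Solver = RingSolver (fromCommutativeRing polyRing (λ p → dec⇒maybe ([] ≋? p)))
    using (_⊜_; _⊕_; _⊗_; ⊝_; Κ)
  open Solver.Ops using (solve₁)

-- Constants and powers of polynomials.

con : ℚ → Poly
con c = c ∷ []

-- Integer factors become constant polynomials, so that the solver can treat them as atoms of the
-- ring.
ν : ℕ → Poly
ν n = con (fromNat n)

ν-suc : ∀ n → ν (suc n) ≋ con 1 +ₚ ν n
ν-suc n = ∷-cong (fromNat-suc n) ≋.refl

infixr 8 _^ₚ_
-- Taken from `_^ⁿ_` so that powers of polynomials agree definitionally with the numerators inside
-- `integrand`.
_^ₚ_ : Poly → ℕ → Poly
p ^ₚ n = num (poly p ^ⁿ n)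

-- This denominator is a product of ones that does not reduce for a variable `n`. It occurs as a
-- factor of the integrand's numerator or denominator and has to be removed.
den-^ⁿ : ∀ p n → den (poly p ^ⁿ n) ≋ con 1
den-^ⁿ p zero    = ≋.refl
den-^ⁿ p (suc n) = ≋.trans (*ₚ-identityˡ _) (den-^ⁿ p n)

derivₚ-^ₚ : ∀ p n → derivₚ (p ^ₚ suc n) ≋ ν (suc n) *ₚ p ^ₚ n *ₚ derivₚ p
derivₚ-^ₚ p zero    = begin
  derivₚ (p *ₚ con 1)     ≈⟨ derivₚ-cong (*ₚ-identityʳ p) ⟩
  derivₚ p                ≈⟨ *ₚ-identityˡ (derivₚ p) ⟨
  con 1 *ₚ derivₚ p       ∎
  where open ≈-Reasoning ≋-setoid
derivₚ-^ₚ p (suc n) = begin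
  derivₚ (p *ₚ p ^ₚ suc n)
    ≈⟨ derivₚ-*ₚ p (p ^ₚ suc n) ⟩
  derivₚ p *ₚ (p *ₚ p ^ₚ n) +ₚ p *ₚ derivₚ (p ^ₚ suc n)
    ≈⟨ +ₚ-congˡ (derivₚ p *ₚ p ^ₚ suc n) (*ₚ-congˡ p (derivₚ-^ₚ p n)) ⟩
  derivₚ p *ₚ (p *ₚ p ^ₚ n) +ₚ p *ₚ (ν (suc n) *ₚ p ^ₚ n *ₚ derivₚ p)
    ≈⟨ solve₁ 4 (λ p p′ q v → p′ ⊗ (p ⊗ q) ⊕ p ⊗ (v ⊗ q ⊗ p′) ⊜ (Κ (con 1) ⊕ v) ⊗ (p ⊗ q) ⊗ p′)
         p (derivₚ p) (p ^ₚ n) (ν (suc n)) ≋.refl ⟩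
  (con 1 +ₚ ν (suc n)) *ₚ (p *ₚ p ^ₚ n) *ₚ derivₚ p
    ≈⟨ *ₚ-congʳ (derivₚ p) (*ₚ-congʳ (p ^ₚ suc n) (ν-suc (suc n))) ⟨
  ν (suc (suc n)) *ₚ p ^ₚ suc n *ₚ derivₚ p ∎
  where open ≈-Reasoning ≋-setoid

-- Rational antiderivatives and the quotient rule.

record Integrable (f : RatFun) : Set where
  constructor integrable
  field
    integral   : RatFun
    integral′≃ : integral ′ ≃ f

-- (N / Bⁿ⁺¹)′ = X / Bⁿ⁺² as an equation between polynomials.
IsAntiderivative : Poly → ℕ → Poly → Poly → Set
IsAntiderivative B n X N = derivₚ N *ₚ B ≋ X +ₚ ν (suc n) *ₚ N *ₚ derivₚ B

-- The numerator and denominator of `f` are prescribed only up to `_≋_`, which leaves room for the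
-- trivial factors of `integrand`.
quotient-rule : ∀ {B X N f} n → NonZeroₚ B → IsAntiderivative B n X N →
  num f ≋ X → den f ≋ B ^ₚ suc (suc n) → Integrable f
quotient-rule {B} {X} {N} {f} n B≉0 N′B≋ num≋ den≋ = integrable N/b (at (begin
  (derivₚ N *ₚ b -ₚ N *ₚ derivₚ b) *ₚ den f
    ≈⟨ *ₚ-cong (+ₚ-congˡ (derivₚ N *ₚ b) (scale-congˡ -1 (*ₚ-congˡ N (derivₚ-^ₚ B n)))) den≋ ⟩
  (derivₚ N *ₚ (B *ₚ q) -ₚ N *ₚ (v *ₚ q *ₚ derivₚ B)) *ₚ (B *ₚ (B *ₚ q))
    -- One factor Bⁿ of the numerator and the factor Bⁿ⁺² of `den f` combine to (Bⁿ⁺¹)², the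
    -- denominator of the derivative.
    ≈⟨ solve₁ 6 (λ N N′ B B′ q v →
           (N′ ⊗ (B ⊗ q) ⊕ ⊝ (N ⊗ (v ⊗ q ⊗ B′))) ⊗ (B ⊗ (B ⊗ q)) ⊜
           (N′ ⊗ B ⊕ ⊝ (v ⊗ N ⊗ B′)) ⊗ ((B ⊗ q) ⊗ (B ⊗ q)))
         N (derivₚ N) B (derivₚ B) q v ≋.refl ⟩
  (derivₚ N *ₚ B -ₚ v *ₚ N *ₚ derivₚ B) *ₚ (b *ₚ b)
    ≈⟨ *ₚ-congʳ (b *ₚ b) (+ₚ-cong N′B≋ ≋.refl) ⟩
  ((X +ₚ v *ₚ N *ₚ derivₚ B) -ₚ v *ₚ N *ₚ derivₚ B) *ₚ (b *ₚ b)
    ≈⟨ solve₁ 3 (λ X y b → ((X ⊕ y) ⊕ ⊝ y) ⊗ (b ⊗ b) ⊜ X ⊗ (b ⊗ b))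
         X (v *ₚ N *ₚ derivₚ B) b ≋.refl ⟩
  X *ₚ (b *ₚ b)
    ≈⟨ *ₚ-congʳ (b *ₚ b) num≋ ⟨
  num f *ₚ (b *ₚ b) ∎))
  where
  open ≈-Reasoning ≋-setoid
  q b v : Poly
  q = B ^ₚ n
  b = B ^ₚ suc n
  v = ν (suc n)
  N/b : RatFun
  N/b = mkRatFun N b (^ⁿ-nonZero (poly B) (suc n) B≉0)

-- The reduction step for a harmonic pair, and its iteration.

-- Expands the derivative of the numerator that `reduction` constructs, by the Leibniz and power
-- rules alone; the relations between `A`, `B`, `C` and `N` enter only afterwards.
derivₚ-reduction : ∀ A B C N γ r n →
  derivₚ (con r *ₚ (C *ₚ A ^ₚ suc (suc n) -ₚ con γ *ₚ (ν (suc (suc n)) *ₚ (B *ₚ B *ₚ N)))) ≋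
  con r *ₚ ((derivₚ C *ₚ A ^ₚ suc (suc n) +ₚ C *ₚ (ν (suc (suc n)) *ₚ A ^ₚ suc n *ₚ derivₚ A))
    -ₚ con γ *ₚ (ν (suc (suc n)) *ₚ ((derivₚ B *ₚ B +ₚ B *ₚ derivₚ B) *ₚ N +ₚ B *ₚ B *ₚ derivₚ N)))
derivₚ-reduction A B C N γ r n = begin
  derivₚ (con r *ₚ (F -ₚ con γ *ₚ (w *ₚ G)))
    ≈⟨ derivₚ-con r (F -ₚ con γ *ₚ (w *ₚ G)) ⟩
  con r *ₚ derivₚ (F -ₚ con γ *ₚ (w *ₚ G))
    ≈⟨ *ₚ-congˡ (con r) (≋.trans (derivₚ-+ₚ F (scale -1 (con γ *ₚ (w *ₚ G))))
         (+ₚ-cong F′ (≋.trans (derivₚ-scale -1 (con γ *ₚ (w *ₚ G))) (scale-congˡ -1 γwG′)))) ⟩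
  _ ∎
  where
  open ≈-Reasoning ≋-setoid
  w F G : Poly
  w = ν (suc (suc n))
  F = C *ₚ A ^ₚ suc (suc n)
  G = B *ₚ B *ₚ N

  derivₚ-con : ∀ c p → derivₚ (con c *ₚ p) ≋ con c *ₚ derivₚ p
  -- `derivₚ (con c)` computes to `[]`, so the first term of the product rule vanishes
  -- definitionally.
  derivₚ-con c = derivₚ-*ₚ (con c)

  F′ : derivₚ F ≋ derivₚ C *ₚ A ^ₚ suc (suc n) +ₚ C *ₚ (w *ₚ A ^ₚ suc n *ₚ derivₚ A)
  F′ = ≋.trans (derivₚ-*ₚ C (A ^ₚ suc (suc n)))
         (+ₚ-congˡ (derivₚ C *ₚ A ^ₚ suc (suc n)) (*ₚ-congˡ C (derivₚ-^ₚ A (suc n))))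

  G′ : derivₚ G ≋ (derivₚ B *ₚ B +ₚ B *ₚ derivₚ B) *ₚ N +ₚ B *ₚ B *ₚ derivₚ N
  G′ = ≋.trans (derivₚ-*ₚ (B *ₚ B) N) (+ₚ-cong (*ₚ-congʳ N (derivₚ-*ₚ B B)) ≋.refl)

  γwG′ : derivₚ (con γ *ₚ (w *ₚ G)) ≋
         con γ *ₚ (w *ₚ ((derivₚ B *ₚ B +ₚ B *ₚ derivₚ B) *ₚ N +ₚ B *ₚ B *ₚ derivₚ N))
  γwG′ = ≋.trans (derivₚ-con γ (w *ₚ G))
           (*ₚ-congˡ (con γ) (≋.trans (derivₚ-con (fromNat (suc (suc n))) G) (*ₚ-congˡ w G′)))

-- The fields are (C/B)′ = A/B² and C(A′B - AB′) = A² + γB², with the subtracted terms moved to the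
-- right so that each left side can be replaced as a product.
record Harmonic (A B : Poly) : Set where
  field
    C : Poly
    γ : ℚ
    potential : derivₚ C *ₚ B ≋ A +ₚ C *ₚ derivₚ B
    jacobian  : C *ₚ derivₚ A *ₚ B ≋ (A *ₚ A +ₚ con γ *ₚ (B *ₚ B)) +ₚ C *ₚ A *ₚ derivₚ B

-- The two relations give ((C/B)(A/B)ⁿ⁺²)′ = (n+3)Aⁿ⁺³/Bⁿ⁺⁴ + (n+2)γAⁿ⁺¹/Bⁿ⁺². Solving for the first
-- term and using N/Bⁿ⁺¹ for the integral of Aⁿ⁺¹/Bⁿ⁺² gives N₁ = (CAⁿ⁺² - γ(n+2)B²N)/(n+3) over
-- Bⁿ⁺³.
reduction : ∀ {A B} → Harmonic A B → ∀ n {N} →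
  IsAntiderivative B n (A ^ₚ suc n) N →
  ∃ (IsAntiderivative B (suc (suc n)) (A ^ₚ suc (suc (suc n))))
reduction {A} {B} H n {N} N′B≋ = N₁ , (begin
  derivₚ (con r *ₚ (C *ₚ (A *ₚ a) -ₚ con γ *ₚ (w *ₚ (B *ₚ B *ₚ N)))) *ₚ B
    ≈⟨ *ₚ-congʳ B (derivₚ-reduction A B C N γ r n) ⟩
  con r *ₚ ((C′ *ₚ (A *ₚ a) +ₚ C *ₚ (w *ₚ a *ₚ A′))
    -ₚ con γ *ₚ (w *ₚ ((B′ *ₚ B +ₚ B *ₚ B′) *ₚ N +ₚ B *ₚ B *ₚ N′))) *ₚ B
    -- Isolates C′B, CA′B and N′B, the left sides of `potential`, `jacobian` and the hypothesis on
    -- `N`.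
    ≈⟨ solve₁ 12 (λ A A′ B B′ C C′ N N′ a γ w r →
           r ⊗ ((C′ ⊗ (A ⊗ a) ⊕ C ⊗ (w ⊗ a ⊗ A′))
             ⊕ ⊝ (γ ⊗ (w ⊗ ((B′ ⊗ B ⊕ B ⊗ B′) ⊗ N ⊕ B ⊗ B ⊗ N′)))) ⊗ B ⊜
           r ⊗ ((A ⊗ a ⊗ (C′ ⊗ B) ⊕ w ⊗ a ⊗ (C ⊗ A′ ⊗ B))
             ⊕ ⊝ (γ ⊗ (w ⊗ ((B ⊗ B) ⊗ ((B′ ⊕ B′) ⊗ N ⊕ N′ ⊗ B))))))
         A A′ B B′ C C′ N N′ a (con γ) w (con r) ≋.refl ⟩
  con r *ₚ ((A *ₚ a *ₚ (C′ *ₚ B) +ₚ w *ₚ a *ₚ (C *ₚ A′ *ₚ B))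
    -ₚ con γ *ₚ (w *ₚ ((B *ₚ B) *ₚ ((B′ +ₚ B′) *ₚ N +ₚ N′ *ₚ B))))
    ≈⟨ *ₚ-congˡ (con r) (+ₚ-cong
         (+ₚ-cong (*ₚ-congˡ (A *ₚ a) potential) (*ₚ-cong (*ₚ-congʳ a (ν-suc (suc n))) jacobian))
         (scale-congˡ -1 (*ₚ-congˡ (con γ) (*ₚ-cong (ν-suc (suc n)) (*ₚ-congˡ (B *ₚ B)
           (+ₚ-congˡ ((B′ +ₚ B′) *ₚ N) N′B≋)))))) ⟩
  con r *ₚ ((A *ₚ a *ₚ (A +ₚ C *ₚ B′)
      +ₚ (con 1 +ₚ v) *ₚ a *ₚ ((A *ₚ A +ₚ con γ *ₚ (B *ₚ B)) +ₚ C *ₚ A *ₚ B′))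
    -ₚ con γ *ₚ ((con 1 +ₚ v) *ₚ ((B *ₚ B) *ₚ ((B′ +ₚ B′) *ₚ N +ₚ (a +ₚ v *ₚ N *ₚ B′)))))
    -- With n+2 written as 1 + v, the two terms γ(1+v)Aⁿ⁺¹B² cancel; what is left carries the factor
    -- 2 + v, that is n+3.
    ≈⟨ solve₁ 9 (λ A B B′ C N a γ v r →
           r ⊗ ((A ⊗ a ⊗ (A ⊕ C ⊗ B′)
               ⊕ (Κ (con 1) ⊕ v) ⊗ a ⊗ ((A ⊗ A ⊕ γ ⊗ (B ⊗ B)) ⊕ C ⊗ A ⊗ B′))
             ⊕ ⊝ (γ ⊗ ((Κ (con 1) ⊕ v) ⊗ ((B ⊗ B) ⊗ ((B′ ⊕ B′) ⊗ N ⊕ (a ⊕ v ⊗ N ⊗ B′)))))) ⊜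
           (r ⊗ (Κ (con 1) ⊕ (Κ (con 1) ⊕ v)) ⊗ (A ⊗ (A ⊗ a))
             ⊕ (Κ (con 1) ⊕ (Κ (con 1) ⊕ v))
               ⊗ (r ⊗ (C ⊗ (A ⊗ a) ⊕ ⊝ (γ ⊗ ((Κ (con 1) ⊕ v) ⊗ (B ⊗ B ⊗ N))))) ⊗ B′))
         A B B′ C N a (con γ) v (con r) ≋.refl ⟩
  con r *ₚ (con 1 +ₚ (con 1 +ₚ v)) *ₚ (A *ₚ (A *ₚ a))
    +ₚ (con 1 +ₚ (con 1 +ₚ v))
      *ₚ (con r *ₚ (C *ₚ (A *ₚ a) -ₚ con γ *ₚ ((con 1 +ₚ v) *ₚ (B *ₚ B *ₚ N)))) *ₚ B′
    ≈⟨ +ₚ-cong (*ₚ-congʳ (A *ₚ (A *ₚ a)) (*ₚ-congˡ (con r) u≋))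
         (*ₚ-congʳ B′ (*ₚ-cong u≋ (*ₚ-congˡ (con r) (+ₚ-congˡ (C *ₚ (A *ₚ a))
           (scale-congˡ -1 (*ₚ-congˡ (con γ) (*ₚ-congʳ (B *ₚ B *ₚ N) (ν-suc (suc n))))))))) ⟨
  con r *ₚ u *ₚ (A *ₚ (A *ₚ a))
    +ₚ u *ₚ (con r *ₚ (C *ₚ (A *ₚ a) -ₚ con γ *ₚ (w *ₚ (B *ₚ B *ₚ N)))) *ₚ B′
    ≈⟨ +ₚ-cong (≋.trans (*ₚ-congʳ (A *ₚ (A *ₚ a)) ru≋1) (*ₚ-identityˡ (A *ₚ (A *ₚ a)))) ≋.refl ⟩
  A *ₚ (A *ₚ a) +ₚ u *ₚ (con r *ₚ (C *ₚ (A *ₚ a) -ₚ con γ *ₚ (w *ₚ (B *ₚ B *ₚ N)))) *ₚ B′ ∎)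
  where
  open ≈-Reasoning ≋-setoid
  open Harmonic H
  r : ℚ
  r = ℚ.1/ (fromNat (suc (suc (suc n))))
  A′ B′ C′ N′ a u v w N₁ : Poly
  A′ = derivₚ A
  B′ = derivₚ B
  C′ = derivₚ C
  N′ = derivₚ N
  a  = A ^ₚ suc n
  u  = ν (suc (suc (suc n)))
  v  = ν (suc n)
  w  = ν (suc (suc n))
  N₁ = con r *ₚ (C *ₚ A ^ₚ suc (suc n) -ₚ con γ *ₚ (w *ₚ (B *ₚ B *ₚ N)))

  u≋ : u ≋ con 1 +ₚ (con 1 +ₚ v)
  u≋ = ≋.trans (ν-suc (suc (suc n))) (+ₚ-congˡ (con 1) (ν-suc (suc n)))

  ru≋1 : con r *ₚ u ≋ con 1
  ru≋1 = ∷-cong (trans (ℚₚ.+-identityʳ _) (ℚₚ.*-inverseˡ (fromNat (suc (suc (suc n)))))) ≋.refl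

-- The base case is C/B itself, and each reduction raises the exponents by two. The form `m ℕ.* 2`
-- makes `suc m ℕ.* 2` compute to `suc (suc (m ℕ.* 2))`.
antiderivative : ∀ {A B} → Harmonic A B → ∀ m →
  ∃ (IsAntiderivative B (m ℕ.* 2) (A ^ₚ suc (m ℕ.* 2)))
antiderivative {A} {B} H zero    = C , (begin
  derivₚ C *ₚ B                       ≈⟨ potential ⟩
  A +ₚ C *ₚ derivₚ B                  ≈⟨ +ₚ-cong (*ₚ-identityʳ A) (*ₚ-congʳ (derivₚ B) (*ₚ-identityˡ C)) ⟨
  A ^ₚ 1 +ₚ ν 1 *ₚ C *ₚ derivₚ B      ∎)
  where
  open ≈-Reasoning ≋-setoid
  open Harmonic H
antiderivative H (suc m) = let N , N′B≋ = antiderivative H m in reduction H (m ℕ.* 2) {N} N′B≋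

harmonic-integrable : ∀ {A B} → Harmonic A B → NonZeroₚ B → ∀ m {f} →
  num f ≋ A ^ₚ suc (m ℕ.* 2) → den f ≋ B ^ₚ suc (suc (m ℕ.* 2)) → Integrable f
harmonic-integrable H B≉0 m num≋ den≋ =
  let N , N′B≋ = antiderivative H m in
  quotient-rule {N = N} (m ℕ.* 2) B≉0 N′B≋ num≋ den≋

-- For explicit polynomials both decisions evaluate to `yes`, so the implicit arguments have the
-- unit type and are filled in automatically.
harmonic : ∀ A B C γ →
  {True (derivₚ C *ₚ B ≋? A +ₚ C *ₚ derivₚ B)} →
  {True (C *ₚ derivₚ A *ₚ B ≋? (A *ₚ A +ₚ con γ *ₚ (B *ₚ B)) +ₚ C *ₚ A *ₚ derivₚ B)} →
  Harmonic A B
harmonic A B C γ {p} {j} = record { C = C ; γ = γ ; potential = toWitness p ; jacobian = toWitness j }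

*ₚ-unitʳ : ∀ {p q r} → p ≋ r → q ≋ con 1 → p *ₚ q ≋ r
*ₚ-unitʳ {r = r} p≋r q≋1 = ≋.trans (*ₚ-cong p≋r q≋1) (*ₚ-identityʳ r)

*ₚ-unitˡ : ∀ {p q r} → p ≋ con 1 → q ≋ r → p *ₚ q ≋ r
*ₚ-unitˡ {r = r} p≋1 q≋r = ≋.trans (*ₚ-cong p≋1 q≋r) (*ₚ-identityˡ r)

-- The four infinite families.

K P Q R : Poly
K = num k
P = num 1-k²
Q = num 1+k-k²
R = num 1-4k-k²

-- The exponent of k in the two families that pair `Q` with `R`: no power of k remains there.
-[2+n]+[1+n]+1≡0 : ∀ n → -[1+ suc n ] ℤ.+ + suc n ℤ.+ + 1 ≡ + 0
-[2+n]+[1+n]+1≡0 n = begin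
  -[1+ suc n ] ℤ.+ + suc n ℤ.+ + 1     ≡⟨ ℤₚ.+-assoc -[1+ suc n ] (+ suc n) (+ 1) ⟩
  -[1+ suc n ] ℤ.+ + (suc n ℕ.+ 1)     ≡⟨ cong (λ i → -[1+ suc n ] ℤ.+ + i) (ℕₚ.+-comm (suc n) 1) ⟩
  -[1+ suc n ] ℤ.+ + suc (suc n)       ≡⟨ ℤₚ.+-inverseˡ (+ suc (suc n)) ⟩
  + 0                                  ∎
  where open ≡-Reasoning

[1+n]-[2+n]+1≡0 : ∀ n → + suc n ℤ.+ -[1+ suc n ] ℤ.+ + 1 ≡ + 0
[1+n]-[2+n]+1≡0 n =
  trans (cong (ℤ._+ + 1) (ℤₚ.+-comm (+ suc n) -[1+ suc n ])) (-[2+n]+[1+n]+1≡0 n)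

num-k^0 : ∀ {z} → z ≡ + 0 → num (k ^⟨ k≄0 ⟩ z) ≋ con 1
num-k^0 refl = ≋.refl

den-k^0 : ∀ {z} → z ≡ + 0 → den (k ^⟨ k≄0 ⟩ z) ≋ con 1
den-k^0 refl = ≋.refl

module _ (m : ℕ) where
  private
    n : ℕ
    n = m ℕ.* 2

    2m+1≡ : 2 ℤ.* + m ℤ.+ 1 ≡ + suc n
    2m+1≡ = begin
      + 2 ℤ.* + m ℤ.+ + 1    ≡⟨ cong (ℤ._+ + 1) (ℤₚ.pos-* 2 m) ⟨
      + (2 ℕ.* m ℕ.+ 1)      ≡⟨ cong +_ (ℕₚ.+-comm (2 ℕ.* m) 1) ⟩
      + suc (2 ℕ.* m)        ≡⟨ cong (λ i → + suc i) (ℕₚ.*-comm 2 m) ⟩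
      + suc n                ∎
      where open ≡-Reasoning

    -2m-2≡ : -2 ℤ.* + m ℤ.- 2 ≡ -[1+ suc n ]
    -2m-2≡ = begin
      ℤ.- + 2 ℤ.* + m ℤ.- + 2       ≡⟨ cong (ℤ._- + 2) (ℤₚ.neg-distribˡ-* (+ 2) (+ m)) ⟨
      ℤ.- (+ 2 ℤ.* + m) ℤ.- + 2     ≡⟨ ℤₚ.neg-distrib-+ (+ 2 ℤ.* + m) (+ 2) ⟨
      ℤ.- (+ 2 ℤ.* + m ℤ.+ + 2)     ≡⟨ cong (λ i → ℤ.- (i ℤ.+ + 2)) (ℤₚ.pos-* 2 m) ⟨
      ℤ.- + (2 ℕ.* m ℕ.+ 2)         ≡⟨ cong (λ i → ℤ.- + i) (ℕₚ.+-comm (2 ℕ.* m) 2) ⟩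
      -[1+ suc (2 ℕ.* m) ]          ≡⟨ cong (λ i → -[1+ suc i ]) (ℕₚ.*-comm 2 m) ⟩
      -[1+ suc n ]                  ∎
      where open ≡-Reasoning

  ∫R/Q : Integrable (integrand 0 (-2 ℤ.* + m ℤ.- 2) (2 ℤ.* + m ℤ.+ 1))
  ∫R/Q rewrite 2m+1≡ | -2m-2≡ =
    -- The Jacobian R′Q - RQ′ is -5(1+k²), C is a fifth of it, and γ comes from R² + 4Q² = 5(1+k²)².
    harmonic-integrable (harmonic R Q (-1 ∷ 0 ∷ -1 ∷ []) 4) 1+k-k²≄0 m
      (*ₚ-unitʳ (*ₚ-unitˡ (*ₚ-unitˡ ≋.refl (den-^ⁿ Q (suc (suc n)))) ≋.refl) (den-k^0 e≡0))
      (*ₚ-unitʳ (*ₚ-unitʳ (*ₚ-identityˡ _) (den-^ⁿ R (suc n))) (num-k^0 e≡0))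
    where
    e≡0 : + 0 ℤ.+ -[1+ suc n ] ℤ.+ + suc n ℤ.+ + 1 ≡ + 0
    e≡0 = -[2+n]+[1+n]+1≡0 n

  ∫P/K : Integrable (integrand (2 ℤ.* + m ℤ.+ 1) 0 0)
  ∫P/K rewrite 2m+1≡ =
    -- Here P′K - PK′ = -(1+k²) is C itself, and P² + 4K² = (1+k²)².
    harmonic-integrable (harmonic P K (-1 ∷ 0 ∷ -1 ∷ []) 4) k≄0 m
      (*ₚ-unitʳ (*ₚ-unitʳ (*ₚ-identityʳ _) ≋.refl) (den-^ⁿ K (suc n ℕ.+ 0 ℕ.+ 0 ℕ.+ 1)))
      (*ₚ-unitˡ (*ₚ-unitʳ (*ₚ-unitʳ (den-^ⁿ P (suc n)) ≋.refl) ≋.refl)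
        (≋.reflexive (cong (K ^ₚ_) (trans (ℕₚ.+-comm _ 1)
          (cong suc (trans (ℕₚ.+-identityʳ _) (ℕₚ.+-identityʳ (suc n))))))))

  ∫K/P : Integrable (integrand (-2 ℤ.* + m ℤ.- 2) 0 0)
  ∫K/P rewrite -2m-2≡ =
    -- Exchanging the two quadratics inverts γ and replaces C by -C/γ; the same holds for `Q` over
    -- `R`.
    harmonic-integrable (harmonic K P (1 ℚ./ 4 ∷ 0 ∷ 1 ℚ./ 4 ∷ []) (1 ℚ./ 4)) 1-k²≄0 m
      -- The exponent of k computes to -(n+1), so its inverse supplies the numerator Kⁿ⁺¹.
      (*ₚ-unitˡ (*ₚ-unitʳ (*ₚ-unitʳ (den-^ⁿ P (suc (suc n))) ≋.refl) ≋.refl) ≋.refl)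
      (*ₚ-unitʳ (*ₚ-unitʳ (*ₚ-identityʳ _) ≋.refl) (den-^ⁿ K (suc n)))

  ∫Q/R : Integrable (integrand 0 (2 ℤ.* + m ℤ.+ 1) (-2 ℤ.* + m ℤ.- 2))
  ∫Q/R rewrite 2m+1≡ | -2m-2≡ =
    harmonic-integrable (harmonic Q R (1 ℚ./ 4 ∷ 0 ∷ 1 ℚ./ 4 ∷ []) (1 ℚ./ 4)) 1-4k-k²≄0 m
      (*ₚ-unitʳ (*ₚ-unitʳ (*ₚ-identityˡ _) (den-^ⁿ R (suc (suc n)))) (den-k^0 e≡0))
      (*ₚ-unitʳ (*ₚ-unitˡ (*ₚ-unitˡ ≋.refl (den-^ⁿ Q (suc n))) ≋.refl) (num-k^0 e≡0))
    where
    e≡0 : + 0 ℤ.+ + suc n ℤ.+ -[1+ suc n ] ℤ.+ + 1 ≡ + 0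
    e≡0 = [1+n]-[2+n]+1≡0 n

IntegrableTriple : ℤ × ℤ × ℤ → Set
IntegrableTriple (a₁ , a₂ , a₃) = Integrable (integrand a₁ a₂ a₃)

familyTriples-integrable : ∀ m → All IntegrableTriple (familyTriples m)
familyTriples-integrable m = ∫R/Q m ∷ ∫P/K m ∷ ∫K/P m ∷ ∫Q/R m ∷ []

-- The twelve triples.

fraction : List ℤ → (d : ℕ) .{{_ : ℕ.NonZero d}} (f : RatFun) → NonZero f → ℕ → RatFun
fraction N d f f≄0 n = mkRatFun (List.map (ℚ._/ d) N) (num (f ^ⁿ n)) (^ⁿ-nonZero f n f≄0)

by-differentiation : ∀ {f} g → {True (num (g ′) *ₚ den f ≋? num f *ₚ den (g ′))} → Integrable f
by-differentiation g {eq} = integrable g (at (toWitness eq))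

twelveTriples-integrable : All IntegrableTriple twelveTriples
twelveTriples-integrable =
    -- Each integrand has a power of a single one of the four polynomials in its denominator, and
    -- the witness has that power lowered by one. The first four triples are the case m = 0 of the
    -- families; their witnesses equal C/B up to a constant.
    by-differentiation (fraction (-2 ∷ -1 ∷ []) 1 1+k-k² 1+k-k²≄0 1)
  ∷ by-differentiation (fraction (-1 ∷ 0 ∷ -1 ∷ []) 1 k k≄0 1)
  ∷ by-differentiation (fraction (1 ∷ []) 2 1-k² 1-k²≄0 1)
  ∷ by-differentiation (fraction (1 ∷ -2 ∷ []) 2 1-4k-k² 1-4k-k²≄0 1)
  ∷ by-differentiation (fraction (2 ∷ 6 ∷ 0 ∷ -5 ∷ []) 15 1+k-k² 1+k-k²≄0 3)
  ∷ by-differentiation (fraction (-1 ∷ 3 ∷ 30 ∷ 0 ∷ 30 ∷ -3 ∷ -1 ∷ []) 3 k k≄0 3)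
  ∷ by-differentiation (fraction (-29 ∷ 6 ∷ 66 ∷ 0 ∷ -21 ∷ -6 ∷ []) 6 1-k² 1-k²≄0 3)
  ∷ by-differentiation (fraction (-1 ∷ 12 ∷ -30 ∷ 20 ∷ 15 ∷ []) 30 1-4k-k² 1-4k-k²≄0 3)
  ∷ by-differentiation (fraction (2 ∷ 8 ∷ 4 ∷ -16 ∷ -5 ∷ []) 20 1+k-k² 1+k-k²≄0 4)
  ∷ by-differentiation (fraction (-1 ∷ -4 ∷ 2 ∷ 32 ∷ 0 ∷ 32 ∷ -2 ∷ -4 ∷ 1 ∷ []) 4 k k≄0 4)
  ∷ by-differentiation (fraction (-7 ∷ 0 ∷ 29 ∷ -8 ∷ -21 ∷ -8 ∷ -1 ∷ []) 2 1-k² 1-k²≄0 4)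
  ∷ by-differentiation (fraction (1 ∷ -6 ∷ 37 ∷ -98 ∷ 35 ∷ 110 ∷ 55 ∷ 10 ∷ []) 10 1-4k-k² 1-4k-k²≄0 4)
  ∷ []

theorem5 : ∀ (a₁ a₂ a₃ : ℤ) →
    ((a₁ , a₂ , a₃) ∈ twelveTriples ⊎ ∃ λ (m : ℕ) → (a₁ , a₂ , a₃) ∈ familyTriples m) →
    ∃ λ (g : RatFun) → g ′ ≃ integrand a₁ a₂ a₃
theorem5 _ _ _ (inj₁ a∈)       = integral , integral′≃
  where open Integrable (All.lookup twelveTriples-integrable a∈)
theorem5 _ _ _ (inj₂ (m , a∈)) = integral , integral′≃
  where open Integrable (All.lookup (familyTriples-integrable m) a∈)
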